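{- Let $k$ be a positive integer. For every integer $n\ge 1$, $$v_k(n)=(k+1)\,e_k(n)=\frac{k+1}{kn+1}\binom{kn+n}{n}.$$
   Context: All paths are lattice paths in $\mathbb{Z}^2$ composed only of unit steps to the right $(1,0)$ and up $(0,1)$. The diagonal is the line $y=x/k$. An excursion of size $n$ is a path from $(0,0)$ to $(kn,n)$ that stays weakly above the diagonal; $e_k(n)$ denotes the number of excursions of size $n$. A valved path is a path that does not cross from on or above the diagonal to below the diagonal, except possibly with its first step; equivalently, no right step other than possibly the first step of the path starts at a point on or above the diagonal and ends at a point strictly below the diagonal. $v_k(n)$ denotes the number of valved paths from $(0,0)$ to $(kn,n)$. -}

module Defs where

open import Data.List using (List; []; _∷_; [_]; _++_; map; filter; length; drop; foldl)
open import Data.List.Membership.Propositional using (_∈_)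
open import Data.List.Membership.Propositional.Properties
  using (∈-map⁺; ∈-map⁻; ∈-++⁺ˡ; ∈-++⁺ʳ; ∈-++⁻)
open import Data.List.Properties using (∷-injectiveʳ)
open import Data.List.Relation.Unary.All as All using (All; []; _∷_)
open import Data.List.Relation.Unary.Any using (here)
open import Data.List.Relation.Unary.Unique.Propositional using (Unique; []; _∷_)
open import Data.List.Relation.Unary.Unique.Propositional.Properties using (map⁺; ++⁺)
open import Data.Nat using (ℕ; zero; suc; _+_; _*_; _≤_; _<_; _≤?_; _<?_)
open import Data.Nat.Properties using (+-suc; +-identityʳ)
open import Data.Product using (_×_; _,_; proj₁; proj₂)
open import Data.Sum using (inj₁; inj₂)
open import Function using (_∘_)
open import Function.Bundles using (_⇔_; mk⇔)
open import Relation.Binary.PropositionalEquality using (_≡_; refl; sym; trans; cong; cong₂)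
open import Relation.Nullary using (¬_; ¬?; _×-dec_)
open import Relation.Unary using (Decidable)

-- Only paths starting at the origin are considered, and neither coordinate
-- decreases along a path, so lattice points with coordinates in ℕ suffice.
Point : Set
Point = ℕ × ℕ

origin : Point
origin = 0 , 0

data Step : Set where
  right up : Step

move : Point → Step → Point
move (x , y) right = suc x , y
move (x , y) up    = x , suc y

Path : Set
Path = List Step

endpoint : Point → Path → Point
endpoint = foldl move

vertices : Point → Path → List Point
vertices p []       = [ p ]
vertices p (s ∷ ss) = p ∷ vertices (move p s) ss

-- Each step of a path, paired with the point from which it is taken.
locatedSteps : Point → Path → List (Point × Step)
locatedSteps p []       = []
locatedSteps p (s ∷ ss) = (p , s) ∷ locatedSteps (move p s) ss

-- For k ≥ 1, the condition y ≥ x / k with the denominator cleared.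
OnOrAbove : ℕ → Point → Set
OnOrAbove k (x , y) = x ≤ k * y

StrictlyBelow : ℕ → Point → Set
StrictlyBelow k (x , y) = k * y < x

-- Half-planes are convex, so it is enough to look at the lattice points
-- of the path.
StaysWeaklyAbove : ℕ → Path → Set
StaysWeaklyAbove k ss = All (OnOrAbove k) (vertices origin ss)

-- An up step never satisfies this, so it only concerns right steps.
CrossesDown : ℕ → Point × Step → Set
CrossesDown k (p , s) = OnOrAbove k p × StrictlyBelow k (move p s)

Valved : ℕ → Path → Set
Valved k ss = All (¬_ ∘ CrossesDown k) (drop 1 (locatedSteps origin ss))

staysWeaklyAbove? : ∀ k → Decidable (StaysWeaklyAbove k)
staysWeaklyAbove? k ss = All.all? (λ (x , y) → x ≤? k * y) (vertices origin ss)

crossesDown? : ∀ k → Decidable (CrossesDown k)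
crossesDown? k (p@(x , y) , s) =
  (x ≤? k * y) ×-dec (k * proj₂ (move p s) <? proj₁ (move p s))

valved? : ∀ k → Decidable (Valved k)
valved? k ss = All.all? (¬? ∘ crossesDown? k) (drop 1 (locatedSteps origin ss))

-- All paths with r right steps and u up steps; pathsTo-correct and
-- pathsTo-unique show that these are exactly the paths from the origin
-- to (r , u), each listed once.
pathsTo : ℕ → ℕ → List Path
pathsTo zero    zero    = [ [] ]
pathsTo (suc r) zero    = map (right ∷_) (pathsTo r zero)
pathsTo zero    (suc u) = map (up ∷_) (pathsTo zero u)
pathsTo (suc r) (suc u) =
  map (right ∷_) (pathsTo r (suc u)) ++ map (up ∷_) (pathsTo (suc r) u)

-- The number of excursions of size n.
e : ℕ → ℕ → ℕ
e k n = length (filter (staysWeaklyAbove? k) (pathsTo (k * n) n))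

-- The number of valved paths from the origin to (k * n , n).
v : ℕ → ℕ → ℕ
v k n = length (filter (valved? k) (pathsTo (k * n) n))

private
  #right #up : Path → ℕ
  #right []           = 0
  #right (right ∷ ss) = suc (#right ss)
  #right (up ∷ ss)    = #right ss
  #up []           = 0
  #up (right ∷ ss) = #up ss
  #up (up ∷ ss)    = suc (#up ss)

  endpoint-# : ∀ x y ss → endpoint (x , y) ss ≡ (x + #right ss , y + #up ss)
  endpoint-# x y []           = sym (cong₂ _,_ (+-identityʳ x) (+-identityʳ y))
  endpoint-# x y (right ∷ ss) =
    trans (endpoint-# (suc x) y ss) (cong (_, y + #up ss) (sym (+-suc x _)))
  endpoint-# x y (up ∷ ss)    =
    trans (endpoint-# x (suc y) ss) (cong (x + #right ss ,_) (sym (+-suc y _)))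

  right⁺ : ∀ r u {ss} → ss ∈ pathsTo r u → (right ∷ ss) ∈ pathsTo (suc r) u
  right⁺ r zero    i = ∈-map⁺ (right ∷_) i
  right⁺ r (suc u) i = ∈-++⁺ˡ (∈-map⁺ (right ∷_) i)

  up⁺ : ∀ r u {ss} → ss ∈ pathsTo r u → (up ∷ ss) ∈ pathsTo r (suc u)
  up⁺ zero    u i = ∈-map⁺ (up ∷_) i
  up⁺ (suc r) u i = ∈-++⁺ʳ (map (right ∷_) (pathsTo r (suc u))) (∈-map⁺ (up ∷_) i)

  complete : ∀ ss → ss ∈ pathsTo (#right ss) (#up ss)
  complete []           = here refl
  complete (right ∷ ss) = right⁺ (#right ss) (#up ss) (complete ss)
  complete (up ∷ ss)    = up⁺ (#right ss) (#up ss) (complete ss)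

  sound : ∀ r u {ss} → ss ∈ pathsTo r u → (#right ss , #up ss) ≡ (r , u)
  sound zero    zero    (here refl) = refl
  sound (suc r) zero    i with ∈-map⁻ (right ∷_) i
  ... | _ , j , refl = cong (λ (a , b) → suc a , b) (sound r zero j)
  sound zero    (suc u) i with ∈-map⁻ (up ∷_) i
  ... | _ , j , refl = cong (λ (a , b) → a , suc b) (sound zero u j)
  sound (suc r) (suc u) i with ∈-++⁻ (map (right ∷_) (pathsTo r (suc u))) i
  ... | inj₁ i′ with ∈-map⁻ (right ∷_) i′
  ...   | _ , j , refl = cong (λ (a , b) → suc a , b) (sound r (suc u) j)
  sound (suc r) (suc u) i | inj₂ i′ with ∈-map⁻ (up ∷_) i′
  ...   | _ , j , refl = cong (λ (a , b) → a , suc b) (sound (suc r) u j)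

pathsTo-correct : ∀ r u ss → ss ∈ pathsTo r u ⇔ endpoint origin ss ≡ (r , u)
pathsTo-correct r u ss = mk⇔
  (λ i → trans (endpoint-# 0 0 ss) (sound r u i))
  (λ eq → from (trans (sym (endpoint-# 0 0 ss)) eq))
  where
  from : ∀ {r u} → (#right ss , #up ss) ≡ (r , u) → ss ∈ pathsTo r u
  from refl = complete ss

pathsTo-unique : ∀ r u → Unique (pathsTo r u)
pathsTo-unique zero    zero    = [] ∷ []
pathsTo-unique (suc r) zero    = map⁺ ∷-injectiveʳ (pathsTo-unique r zero)
pathsTo-unique zero    (suc u) = map⁺ ∷-injectiveʳ (pathsTo-unique zero u)
pathsTo-unique (suc r) (suc u) =
  ++⁺ (map⁺ ∷-injectiveʳ (pathsTo-unique r (suc u)))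
      (map⁺ ∷-injectiveʳ (pathsTo-unique (suc r) u))
      disjoint
  where
  disjoint : ∀ {ss} → ¬ (ss ∈ map (right ∷_) (pathsTo r (suc u))
                       × ss ∈ map (up ∷_) (pathsTo (suc r) u))
  disjoint (i , j) with ∈-map⁻ (right ∷_) i | ∈-map⁻ (up ∷_) j
  ... | _ , _ , refl | _ , _ , ()

-- Let the height of (x , y) be k y - x. A valved path whose first step is right
-- has the form R A U B: A runs from height -1 to j - k through negative heights
-- for some 0 ≤ j < k, and B from j to 0 through nonnegative heights. For each j,
-- U B R Aʳᵉᵛ is an excursion, cut at its first passage to height k - 1 - j, so
-- there are k e(n) such paths; those whose first step is up are the excursions.
-- Counting by length turns this bijection into the linear recursion behind
-- G + D = k N. The closed form comes from the ballot formula
-- e = C(L, n) - k C(L, n - 1) with L = k n + n, whose extension to walks from any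
-- height obeys Pascal's rule.
module Submission where

open import Defs
open import Data.Nat using (ℕ; zero; suc; _+_; _*_; _<_; _≤_; _≥_; s≤s; z≤n)
open import Data.Nat.Combinatorics using (_C_; k>n⇒nCk≡0; nCk+nC[k+1]≡[n+1]C[k+1])
open import Data.Nat.Properties
open import Data.Nat.Tactic.RingSolver using (solve-∀)
import Data.Integer as ℤ
import Data.Integer.Properties as ℤ
open import Data.List using (List; []; _∷_; _++_; map; filter; length)
open import Data.List.Properties using (filter-++; length-++; filter-≐; filter-none)
open import Data.List.Relation.Unary.All as All using (All; []; _∷_)
open import Data.Product using (_×_; _,_)
open import Data.Rational as ℚ using (_/_)
import Data.Rational.Properties as ℚ
open import Data.Rational.Unnormalised as ℚᵘ using (mkℚᵘ; *≡*)
import Data.Rational.Unnormalised.Properties as ℚᵘ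
open import Function using (_∘_; const)
open import Relation.Binary.PropositionalEquality
  using (_≡_; refl; sym; trans; cong; cong₂; subst; module ≡-Reasoning)
open import Relation.Nullary using (¬_; ¬?; yes; no)
open import Relation.Nullary.Negation using (contradiction)
open import Relation.Unary using (Decidable; _≐_)

open ≡-Reasoning

-- Sequences shifted by `k`.

-- Models an up step from height `-1-h`. If `h ≥ k` the walk is still negative, and `φ` takes the
-- new index `h - k`; otherwise it lands on the nonnegative height `k - 1 - h`, the argument of `ψ`.
jump : ℕ → (ℕ → ℕ) → (ℕ → ℕ) → ℕ → ℕ
jump zero    φ ψ h       = φ h
jump (suc k) φ ψ zero    = ψ k
jump (suc k) φ ψ (suc h) = jump k φ ψ h

-- Multiplication by `z^k` on coefficient sequences: a step into height `h` from height `h - k`,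
-- which must be nonnegative.
shift : ℕ → (ℕ → ℕ) → ℕ → ℕ
shift k φ = jump k φ (const 0)

jump-cong : ∀ k {φ φ′ ψ ψ′} → (∀ h → φ h ≡ φ′ h) → (∀ h → ψ h ≡ ψ′ h) →
  ∀ h → jump k φ ψ h ≡ jump k φ′ ψ′ h
jump-cong zero    eq eq′ h       = eq h
jump-cong (suc k) eq eq′ zero    = eq′ k
jump-cong (suc k) eq eq′ (suc h) = jump-cong k eq eq′ h

jump-+ : ∀ k {φ φ′ ψ ψ′} h →
  jump k (λ i → φ i + φ′ i) (λ i → ψ i + ψ′ i) h ≡ jump k φ ψ h + jump k φ′ ψ′ h
jump-+ zero    h       = refl
jump-+ (suc k) zero    = refl
jump-+ (suc k) (suc h) = jump-+ k h

jump-* : ∀ k c {φ ψ} h →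
  jump k (λ i → c * φ i) (λ i → c * ψ i) h ≡ c * jump k φ ψ h
jump-* zero    c h       = refl
jump-* (suc k) c zero    = refl
jump-* (suc k) c (suc h) = jump-* k c h

-- Separates the linear operator `shift k` from an inhomogeneous term, so that `G` can be compared
-- with solutions of the homogeneous recursion.
jump-split : ∀ k φ ψ h → jump k φ ψ h ≡ shift k φ h + jump k (const 0) ψ h
jump-split zero    φ ψ h       = sym (+-identityʳ _)
jump-split (suc k) φ ψ zero    = refl
jump-split (suc k) φ ψ (suc h) = jump-split k φ ψ h

shift-+ : ∀ k φ φ′ h → shift k (λ i → φ i + φ′ i) h ≡ shift k φ h + shift k φ′ h
shift-+ k φ φ′ h = jump-+ k {φ} {φ′} {const 0} {const 0} h

shift-* : ∀ k c φ h → shift k (λ i → c * φ i) h ≡ c * shift k φ h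
shift-* k c φ h = trans
  (jump-cong k (λ _ → refl) (λ _ → sym (*-zeroʳ c)) h)
  (jump-* k c {φ} {const 0} h)

shift-0 : ∀ k h → shift k (const 0) h ≡ 0
shift-0 zero    h       = refl
shift-0 (suc k) zero    = refl
shift-0 (suc k) (suc h) = shift-0 k h

-- The critical index is `suc h ≡ k`, where the left side reads `φ 0` and the right side reads the
-- padding `0`.
shift-suc : ∀ k φ h → φ 0 ≡ 0 → shift k φ (suc h) ≡ shift k (φ ∘ suc) h
shift-suc zero          φ h       φ0 = refl
shift-suc (suc zero)    φ zero    φ0 = φ0
shift-suc (suc (suc k)) φ zero    φ0 = refl
shift-suc (suc k)       φ (suc h) φ0 = shift-suc k φ h φ0

shift-zero : ∀ k φ → φ 0 ≡ 0 → shift k φ 0 ≡ 0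
shift-zero zero    φ φ0 = φ0
shift-zero (suc k) φ φ0 = refl

jump-≥ : ∀ k φ ψ {h i} → k + i ≡ h → jump k φ ψ h ≡ φ i
jump-≥ zero    φ ψ refl = refl
jump-≥ (suc k) φ ψ refl = jump-≥ k φ ψ refl

jump-< : ∀ k φ ψ {h j} → suc h + j ≡ k → jump k φ ψ h ≡ ψ j
jump-< _ φ ψ {zero}  refl = refl
jump-< _ φ ψ {suc h} refl = jump-< _ φ ψ {h} refl

δ : ℕ → ℕ → ℕ
δ zero    zero    = 1
δ zero    (suc _) = 0
δ (suc _) zero    = 0
δ (suc a) (suc h) = δ a h

+-interchange : ∀ m n o p → (m + n) + (o + p) ≡ (m + o) + (n + p)
+-interchange = solve-∀

-- Walks by height and the first-passage recursion.

module _ (k : ℕ) where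

  -- Walks of L steps, each -1 or +k, from height a to height h through
  -- nonnegative heights.
  N : ℕ → ℕ → ℕ → ℕ
  N zero    a h = δ a h
  N (suc L) a h = shift 1 (λ b → N L b h) a + N L (k + a) h

  -- `N` is defined by its first step; the comparison with `G` needs the recursion in the final
  -- height. Removing a first step and removing a last step commute (`swap`), so induction on `L`
  -- applies.
  N-last : ∀ L a h → N (suc L) a h ≡ N L a (suc h) + shift k (N L a) h
  N-last zero a h = cong₂ _+_ (below a h) (above k h)
    where
    below : ∀ a h → shift 1 (λ b → δ b h) a ≡ δ a (suc h)
    below zero    h = refl
    below (suc a) h = refl
    above : ∀ k h → δ (k + a) h ≡ shift k (δ a) h
    above zero    h       = refl
    above (suc k) zero    = refl
    above (suc k) (suc h) = above k h
  N-last (suc L) a h = begin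
    shift 1 (λ b → N (suc L) b h) a + N (suc L) (k + a) h
      ≡⟨ cong₂ _+_ (jump-cong 1 (λ b → N-last L b h) (λ _ → refl) a) (N-last L (k + a) h) ⟩
    shift 1 (λ b → N L b (suc h) + shift k (N L b) h) a + (q + t)
      ≡⟨ cong (_+ (q + t)) (trans (shift-+ 1 _ _ a) (cong (p +_) (swap a))) ⟩
    (p + s) + (q + t)
      ≡⟨ +-interchange p s q t ⟩
    (p + q) + (s + t)
      ≡⟨ cong ((p + q) +_) (shift-+ k _ _ h) ⟨
    N (suc L) a (suc h) + shift k (N (suc L) a) h ∎
    where
    p = shift 1 (λ b → N L b (suc h)) a
    q = N L (k + a) (suc h)
    s = shift k (λ i → shift 1 (λ b → N L b i) a) h
    t = shift k (N L (k + a)) h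
    swap : ∀ a → shift 1 (λ b → shift k (N L b) h) a ≡
                 shift k (λ i → shift 1 (λ b → N L b i) a) h
    swap zero    = sym (shift-0 k h)
    swap (suc a) = refl

  N-vanish : ∀ L a h → L + h < a → N L a h ≡ 0
  N-vanish zero    (suc a) zero    _       = refl
  N-vanish zero    (suc a) (suc h) (s≤s p) = N-vanish zero a h p
  N-vanish (suc L) (suc a) h       (s≤s p) = cong₂ _+_
    (N-vanish L a h p)
    (N-vanish L (k + suc a) h (≤-trans (m≤n⇒m≤1+n p) (m≤n+m (suc a) k)))

  -- Walks of L steps from height -1-h to height 0 that never get negative
  -- after reaching a nonnegative height.
  G : ℕ → ℕ → ℕ
  G zero    h = 0
  G (suc L) h = G L (suc h) + jump k (G L) (λ a → N L a 0) h

  -- Even `L` up steps gain only `k * L`, which leaves the height negative.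
  G-vanish : ∀ L h → k * L ≤ h → G L h ≡ 0
  G-vanish zero    h p = refl
  G-vanish (suc L) h p = cong₂ _+_
    (G-vanish L (suc h) (≤-trans (*-monoʳ-≤ k (n≤1+n L)) (m≤n⇒m≤1+n p)))
    (far k h (G-vanish L) (subst (_≤ h) (*-suc k L) p))
    where
    far : ∀ j {φ ψ m} h → (∀ i → m ≤ i → φ i ≡ 0) → j + m ≤ h → jump j φ ψ h ≡ 0
    far zero    h       z p       = z h p
    far (suc j) (suc h) z (s≤s p) = far j h z p

  -- N L (a ∸ suc m) (h ∸ suc m) counts the walks from a to h that stay above m,
  -- i.e. have not yet made the passage to m; D L a h sums it over m.
  D : ℕ → ℕ → ℕ → ℕ
  D L zero    h       = 0
  D L (suc a) zero    = 0
  D L (suc a) (suc h) = N L a h + D L a h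

  D-zero : ∀ a h → D zero a h ≡ a * δ a h
  D-zero zero    h       = refl
  D-zero (suc a) zero    = sym (*-zeroʳ a)
  D-zero (suc a) (suc h) = cong (δ a h +_) (D-zero a h)

  D-0 : ∀ L a → D L a 0 ≡ 0
  D-0 L zero    = refl
  D-0 L (suc a) = refl

  -- Apply `N-last` in every summand. `D L a (suc h)` has one further summand, for level `h`, when
  -- `h < a`: it is `N L (a - 1 - h) 0`, the walks whose next down step is their first passage to
  -- `h`. The `jump` term on the left accounts for it.
  D-last : ∀ L a h →
    D (suc L) a h + jump a (const 0) (λ b → N L b 0) h ≡ D L a (suc h) + shift k (D L a) h
  D-last L zero    h       = sym (shift-0 k h)
  D-last L (suc a) zero    = sym (begin
    N L a 0 + D L a 0 + shift k (D L (suc a)) 0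
      ≡⟨ cong₂ _+_ (cong (N L a 0 +_) (D-0 L a)) (shift-zero k _ refl) ⟩
    N L a 0 + 0 + 0
      ≡⟨ trans (+-identityʳ _) (+-identityʳ _) ⟩
    N L a 0 ∎)
  D-last L (suc a) (suc h) = begin
    N (suc L) a h + D (suc L) a h + jump a (const 0) (λ b → N L b 0) h
      ≡⟨ +-assoc (N (suc L) a h) _ _ ⟩
    N (suc L) a h + (D (suc L) a h + jump a (const 0) (λ b → N L b 0) h)
      ≡⟨ cong₂ _+_ (N-last L a h) (D-last L a h) ⟩
    N L a (suc h) + shift k (N L a) h + (D L a (suc h) + shift k (D L a) h)
      ≡⟨ +-interchange (N L a (suc h)) _ _ _ ⟩
    D L (suc a) (suc (suc h)) + (shift k (N L a) h + shift k (D L a) h)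
      ≡⟨ cong (D L (suc a) (suc (suc h)) +_) (shift-+ k (N L a) (D L a) h) ⟨
    D L (suc a) (suc (suc h)) + shift k (D L (suc a) ∘ suc) h
      ≡⟨ cong (D L (suc a) (suc (suc h)) +_) (shift-suc k (D L (suc a)) h refl) ⟨
    D L (suc a) (suc (suc h)) + shift k (D L (suc a)) (suc h) ∎

  -- Both sides obey `X (suc L) h = X L (suc h) + shift k (X L)
  -- h`: the first-passage term enters `G` with a plus and `D` with a minus, and cancels in the sum.
  -- Combinatorially, `k * N L k h` counts pairs of a walk and a level below `k`; `D` takes the
  -- pairs whose level has not been reached, hence `G` takes the others.
  G+D : ∀ L h → G L h + D L k h ≡ k * N L k h
  G+D zero    h = D-zero k h
  G+D (suc L) h = begin
    G L (suc h) + jump k (G L) ψ h + D (suc L) k h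
      ≡⟨ cong (λ j → G L (suc h) + j + D (suc L) k h) (jump-split k (G L) ψ h) ⟩
    G L (suc h) + (shift k (G L) h + jump k (const 0) ψ h) + D (suc L) k h
      ≡⟨ regroup (G L (suc h)) (shift k (G L) h) _ _ ⟩
    G L (suc h) + shift k (G L) h + (D (suc L) k h + jump k (const 0) ψ h)
      ≡⟨ cong (G L (suc h) + shift k (G L) h +_) (D-last L k h) ⟩
    G L (suc h) + shift k (G L) h + (D L k (suc h) + shift k (D L k) h)
      ≡⟨ +-interchange (G L (suc h)) _ _ _ ⟩
    G L (suc h) + D L k (suc h) + (shift k (G L) h + shift k (D L k) h)
      ≡⟨ cong (G L (suc h) + D L k (suc h) +_) (shift-+ k (G L) (D L k) h) ⟨
    G L (suc h) + D L k (suc h) + shift k (λ i → G L i + D L k i) h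
      ≡⟨ cong₂ _+_ (G+D L (suc h)) (jump-cong k (G+D L) (λ _ → refl) h) ⟩
    k * N L k (suc h) + shift k (λ i → k * N L k i) h
      ≡⟨ cong (k * N L k (suc h) +_) (shift-* k k (N L k) h) ⟩
    k * N L k (suc h) + k * shift k (N L k) h
      ≡⟨ *-distribˡ-+ k (N L k (suc h)) _ ⟨
    k * (N L k (suc h) + shift k (N L k) h)
      ≡⟨ cong (k *_) (N-last L k h) ⟨
    k * N (suc L) k h ∎
    where
    ψ = λ a → N L a 0
    regroup : ∀ m n o p → m + (n + o) + p ≡ m + n + (p + o)
    regroup = solve-∀

  -- A walk that ends at height 0 has passed all `k` levels, so `D` contributes nothing.
  G≡k*N : ∀ L → G L 0 ≡ k * N L k 0
  G≡k*N L = begin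
    G L 0           ≡⟨ +-identityʳ _ ⟨
    G L 0 + 0       ≡⟨ cong (G L 0 +_) (D-0 L k) ⟨
    G L 0 + D L k 0 ≡⟨ G+D L 0 ⟩
    k * N L k 0     ∎

-- Binomial identities and the ballot formula.

-- Pascal's rule on both sides reduces the claim at `(suc m, suc i)` to those at `(m, suc i)` and
-- `(suc m, i)`. Writing the upper index as `m + j` avoids subtraction.
C-absorb : ∀ m j → suc j * ((m + j) C suc j) ≡ m * ((m + j) C j)
C-absorb zero    j       = trans (cong (suc j *_) (k>n⇒nCk≡0 (n<1+n j))) (*-zeroʳ j)
C-absorb (suc m) zero    = begin
  1 * (suc (m + 0) C 1)
    ≡⟨ cong (1 *_) (nCk+nC[k+1]≡[n+1]C[k+1] (m + 0) 0) ⟨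
  1 * (1 + (m + 0) C 1)
    ≡⟨ *-distribˡ-+ 1 1 ((m + 0) C 1) ⟩
  1 + 1 * ((m + 0) C 1)
    ≡⟨ cong suc (C-absorb m 0) ⟩
  suc m * 1 ∎
C-absorb (suc m) (suc i) = begin
  suc (suc i) * (suc M C suc (suc i))
    ≡⟨ cong (suc (suc i) *_) (nCk+nC[k+1]≡[n+1]C[k+1] M (suc i)) ⟨
  suc (suc i) * (X + M C suc (suc i))
    ≡⟨ *-distribˡ-+ (suc (suc i)) X _ ⟩
  suc (suc i) * X + suc (suc i) * (M C suc (suc i))
    ≡⟨ cong (suc (suc i) * X +_) (C-absorb m (suc i)) ⟩
  suc (suc i) * X + m * X
    ≡⟨ regroup i m X ⟩
  suc i * X + suc m * X
    ≡⟨ cong (_+ suc m * X) (subst (λ n → suc i * (n C suc i) ≡ suc m * (n C i))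
         (sym (+-suc m i)) (C-absorb (suc m) i)) ⟩
  suc m * (M C i) + suc m * X
    ≡⟨ *-distribˡ-+ (suc m) (M C i) X ⟨
  suc m * (M C i + X)
    ≡⟨ cong (suc m *_) (nCk+nC[k+1]≡[n+1]C[k+1] M i) ⟩
  suc m * (suc M C suc i) ∎
  where
  M = m + suc i
  X = M C suc i
  regroup : ∀ i m x → suc (suc i) * x + m * x ≡ suc i * x + suc m * x
  regroup = solve-∀

_C⁻_ : ℕ → ℕ → ℕ
n C⁻ zero  = 0
n C⁻ suc u = n C u

C⁻-pascal : ∀ n u → n C⁻ u + n C u ≡ suc n C u
C⁻-pascal n zero    = refl
C⁻-pascal n (suc u) = nCk+nC[k+1]≡[n+1]C[k+1] n u

module _ (k : ℕ) where

  N-direct : ∀ a → N k a a 0 ≡ 1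
  N-direct zero    = refl
  N-direct (suc a) = cong₂ _+_ (N-direct a)
    (N-vanish k a (k + suc a) 0
      (≤-trans (s≤s (≤-reflexive (+-identityʳ a))) (m≤n+m (suc a) k)))

  -- Here `u` is the number of up steps, fixed by `L` and `a`. The first-step recursion of `N`
  -- matches Pascal's rule for both binomials. For `u = 0` only the straight descent remains.
  ballot : ∀ L a u → L ≡ a + (k * u + u) → N k L a 0 + k * (L C⁻ u) ≡ L C u
  ballot L a zero eq = begin
    N k L a 0 + k * 0 ≡⟨ cong₂ _+_ (cong (λ b → N k L b 0) (sym L≡a)) (*-zeroʳ k) ⟩
    N k L L 0 + 0     ≡⟨ cong (_+ 0) (N-direct L) ⟩
    1                 ∎
    where
    L≡a : L ≡ a
    L≡a = trans eq (trans (cong (λ z → a + (z + 0)) (*-zeroʳ k)) (+-identityʳ a))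
  ballot zero a (suc u) eq = contradiction
    (trans eq (trans (cong (a +_) (+-suc (k * suc u) u)) (+-suc a _))) λ ()
  ballot (suc L) zero (suc u) eq = begin
    N k L (k + 0) 0 + k * (suc L C u)
      ≡⟨ cong (λ c → N k L (k + 0) 0 + k * c) (C⁻-pascal L u) ⟨
    N k L (k + 0) 0 + k * (L C⁻ u + L C u)
      ≡⟨ regroup (N k L (k + 0) 0) k (L C⁻ u) (L C u) ⟩
    N k L (k + 0) 0 + k * (L C⁻ u) + k * (L C u)
      ≡⟨ cong₂ _+_ (ballot L (k + 0) u (trans L≡ (expand k u))) (sym absorb) ⟩
    L C u + L C suc u
      ≡⟨ nCk+nC[k+1]≡[n+1]C[k+1] L u ⟩
    suc L C suc u ∎
    where
    L≡ : L ≡ k * suc u + u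
    L≡ = suc-injective (trans eq (+-suc (k * suc u) u))
    expand : ∀ k u → k * suc u + u ≡ k + 0 + (k * u + u)
    expand = solve-∀
    regroup : ∀ n k c d → n + k * (c + d) ≡ n + k * c + k * d
    regroup = solve-∀
    -- The boundary condition: the formula continued to starting height `-1` gives `0`, so the
    -- missing down step from height 0 costs nothing.
    absorb : L C suc u ≡ k * (L C u)
    absorb = *-cancelˡ-≡ _ _ (suc u) (begin
      suc u * (L C suc u)
        ≡⟨ subst (λ n → suc u * (n C suc u) ≡ k * suc u * (n C u)) (sym L≡)
             (C-absorb (k * suc u) u) ⟩
      k * suc u * (L C u)
        ≡⟨ cong (_* (L C u)) (*-comm k (suc u)) ⟩
      suc u * k * (L C u)
        ≡⟨ *-assoc (suc u) k _ ⟩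
      suc u * (k * (L C u)) ∎)
  ballot (suc L) (suc a) (suc u) eq = begin
    N k L a 0 + N k L (k + suc a) 0 + k * (suc L C u)
      ≡⟨ cong (λ c → N k L a 0 + N k L (k + suc a) 0 + k * c) (C⁻-pascal L u) ⟨
    N k L a 0 + N k L (k + suc a) 0 + k * (L C⁻ u + L C u)
      ≡⟨ regroup (N k L a 0) _ k _ _ ⟩
    (N k L (k + suc a) 0 + k * (L C⁻ u)) + (N k L a 0 + k * (L C u))
      ≡⟨ cong₂ _+_ (ballot L (k + suc a) u (trans L≡ (expand k a u))) (ballot L a (suc u) L≡) ⟩
    L C u + L C suc u
      ≡⟨ nCk+nC[k+1]≡[n+1]C[k+1] L u ⟩
    suc L C suc u ∎
    where
    L≡ : L ≡ a + (k * suc u + suc u)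
    L≡ = suc-injective eq
    expand : ∀ k a u → a + (k * suc u + suc u) ≡ k + suc a + (k * u + u)
    expand = solve-∀
    regroup : ∀ m n k c d → m + n + k * (c + d) ≡ (n + k * c) + (m + k * d)
    regroup = solve-∀

  -- The ballot formula at height 0 reads `X + k * A ≡ B`, and absorption gives
  -- `n * B ≡ suc (k * n) * A`. Adding `k * n * B` to both sides eliminates `A` without subtraction.
  N-closed : ∀ u → let n = suc u in suc (k * n) * N k (k * n + n) 0 0 ≡ (k * n + n) C n
  N-closed u = +-cancelʳ-≡ (k * n * B) _ _ (begin
    suc (k * n) * X + k * n * B
      ≡⟨ cong (suc (k * n) * X +_) (*-assoc k n B) ⟩
    suc (k * n) * X + k * (n * B)
      ≡⟨ cong (λ z → suc (k * n) * X + k * z) absorb ⟩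
    suc (k * n) * X + k * (suc (k * n) * A)
      ≡⟨ regroup (suc (k * n)) k X A ⟩
    suc (k * n) * (X + k * A)
      ≡⟨ cong (suc (k * n) *_) (ballot (k * n + n) 0 n refl) ⟩
    B + k * n * B ∎)
    where
    n = suc u
    X = N k (k * n + n) 0 0
    A = (k * n + n) C u
    B = (k * n + n) C n
    absorb : n * B ≡ suc (k * n) * A
    absorb = subst (λ m → n * (m C n) ≡ suc (k * n) * (m C u))
      (sym (+-suc (k * n) u)) (C-absorb (suc (k * n)) u)
    regroup : ∀ m k x a → m * x + k * (m * a) ≡ m * (x + k * a)
    regroup = solve-∀

-- Counting in filtered lists.

count : ∀ {A : Set} {P : A → Set} → Decidable P → List A → ℕ
count P? xs = length (filter P? xs)

count-++ : ∀ {A : Set} {P : A → Set} (P? : Decidable P) xs ys →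
  count P? (xs ++ ys) ≡ count P? xs + count P? ys
count-++ P? xs ys = trans (cong length (filter-++ P? xs ys)) (length-++ (filter P? xs))

count-map : ∀ {A B : Set} {P : B → Set} (P? : Decidable P) (f : A → B) xs →
  count P? (map f xs) ≡ count (P? ∘ f) xs
count-map P? f []       = refl
count-map P? f (x ∷ xs) with P? (f x)
... | yes _ = cong suc (count-map P? f xs)
... | no  _ = count-map P? f xs

count-≐ : ∀ {A : Set} {P Q : A → Set} (P? : Decidable P) (Q? : Decidable Q) →
  P ≐ Q → ∀ xs → count P? xs ≡ count Q? xs
count-≐ P? Q? P≐Q xs = cong length (filter-≐ P? Q? P≐Q xs)

count-none : ∀ {A : Set} {P : A → Set} (P? : Decidable P) →
  (∀ x → ¬ P x) → ∀ xs → count P? xs ≡ 0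
count-none P? ¬P xs = cong length (filter-none P? (All.universal ¬P xs))

-- From lattice paths to walks of heights.

module _ (k : ℕ) where

  NoCross : Point → Path → Set
  NoCross p ss = All (¬_ ∘ CrossesDown k) (locatedSteps p ss)

  noCross? : ∀ p → Decidable (NoCross p)
  noCross? p ss = All.all? (¬? ∘ crossesDown? k) (locatedSteps p ss)

  V : Point → ℕ → ℕ → ℕ
  V p r u = count (noCross? p) (pathsTo r u)

  count-free : ∀ p s xs → ¬ CrossesDown k (p , s) →
    count (noCross? p) (map (s ∷_) xs) ≡ count (noCross? (move p s)) xs
  count-free p s xs ¬c = trans (count-map (noCross? p) (s ∷_) xs)
    (count-≐ _ (noCross? (move p s)) (All.tail , (¬c ∷_)) xs)

  count-blocked : ∀ p s xs → CrossesDown k (p , s) →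
    count (noCross? p) (map (s ∷_) xs) ≡ 0
  count-blocked p s xs c = trans (count-map (noCross? p) (s ∷_) xs)
    (count-none _ (λ ss → λ { (¬c ∷ _) → ¬c c }) xs)

  up-free : ∀ x y → ¬ CrossesDown k ((x , y) , up)
  up-free x y (above , below) =
    <⇒≱ below (≤-trans above (*-monoʳ-≤ k (n≤1+n y)))

  right-free-above : ∀ {x y a} → x + suc a ≡ k * y → ¬ CrossesDown k ((x , y) , right)
  right-free-above {x} {y} {a} eq (_ , below) = <⇒≱ below
    (subst (suc x ≤_) (trans (sym (+-suc x a)) eq) (s≤s (m≤m+n x a)))

  right-free-below : ∀ {x y h} → x ≡ k * y + suc h → ¬ CrossesDown k ((x , y) , right)
  right-free-below {x} {y} {h} eq (above , _) = <⇒≱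
    (subst (k * y <_) (sym eq) (m<m+n (k * y) (s≤s z≤n))) above

  right-blocked : ∀ {x y} → x + 0 ≡ k * y → CrossesDown k ((x , y) , right)
  right-blocked {x} eq =
    ≤-reflexive (trans (sym (+-identityʳ x)) eq) ,
    s≤s (≤-reflexive (trans (sym eq) (+-identityʳ x)))

  -- The origin lies on the diagonal, and a path that starts weakly above it can only get below by a
  -- crossing. Thus `V` serves both excursions and the tails of valved paths.
  excursion-≐ : StaysWeaklyAbove k ≐ NoCross origin
  excursion-≐ = (λ {ss} → to origin ss) , (λ {ss} → from origin ss z≤n)
    where
    first : ∀ p ss → All (OnOrAbove k) (vertices p ss) → OnOrAbove k p
    first p []       (a ∷ _) = a
    first p (s ∷ ss) (a ∷ _) = a
    to : ∀ p ss → All (OnOrAbove k) (vertices p ss) → NoCross p ss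
    to p []       _        = []
    to p (s ∷ ss) (_ ∷ as) =
      (λ (_ , below) → <⇒≱ below (first (move p s) ss as)) ∷ to (move p s) ss as
    from : ∀ p ss → OnOrAbove k p → NoCross p ss → All (OnOrAbove k) (vertices p ss)
    from p []       a _         = a ∷ []
    from p (s ∷ ss) a (¬c ∷ cs) =
      a ∷ from (move p s) ss (≮⇒≥ (λ below → ¬c (a , below))) cs

  module _ (k≥1 : k ≥ 1) where

    -- The hypotheses say that the current height is `a` and that the remaining steps end on the
    -- diagonal. Following the next step then reproduces the recursion of `N`.
    V-above : ∀ r u {x y} a → x + a ≡ k * y → a + k * u ≡ r → V (x , y) r u ≡ N k (r + u) a 0
    V-above-up : ∀ r u {x y} a → x + a ≡ k * y → a + k * suc u ≡ r →
      V (x , suc y) r u ≡ N k (r + u) (k + a) 0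

    V-above zero zero zero on end = refl
    V-above (suc r) zero {x} {y} zero on end = contradiction (trans (sym (*-zeroʳ k)) end) λ ()
    V-above (suc r) zero {x} {y} (suc a) on end = begin
      count (noCross? (x , y)) (map (right ∷_) (pathsTo r zero))
        ≡⟨ count-free (x , y) right (pathsTo r zero) (right-free-above on) ⟩
      V (suc x , y) r zero
        ≡⟨ V-above r zero a (trans (sym (+-suc x a)) on) (suc-injective end) ⟩
      N k (r + 0) a 0
        ≡⟨ +-identityʳ _ ⟨
      N k (r + 0) a 0 + 0
        -- `N` also allows an up step here, but from the height it reaches the remaining steps
        -- cannot descend to 0.
        ≡⟨ cong (N k (r + 0) a 0 +_) (N-vanish k (r + 0) (k + suc a) 0 short) ⟨
      N k (suc r + 0) (suc a) 0 ∎
      where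
      r≡a : r + 0 + 0 ≡ a
      r≡a = begin
        r + 0 + 0 ≡⟨ trans (+-identityʳ _) (+-identityʳ r) ⟩
        r         ≡⟨ suc-injective end ⟨
        a + k * 0 ≡⟨ cong (a +_) (*-zeroʳ k) ⟩
        a + 0     ≡⟨ +-identityʳ a ⟩
        a         ∎
      short : r + 0 + 0 < k + suc a
      short = ≤-trans (s≤s (≤-reflexive r≡a)) (m≤n+m (suc a) k)
    -- Up steps without right steps would force `k ≡ 0`.
    V-above zero (suc u) a on end = contradiction
      (subst (_≥ 1) (m*n≡0⇒m≡0 k (suc u) (m+n≡0⇒n≡0 a end)) k≥1) λ ()
    V-above (suc r) (suc u) {x} {y} zero on end = begin
      count (noCross? (x , y)) (map (right ∷_) (pathsTo r (suc u)) ++ map (up ∷_) (pathsTo (suc r) u))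
        ≡⟨ count-++ (noCross? (x , y)) (map (right ∷_) (pathsTo r (suc u))) _ ⟩
      _ ≡⟨ cong₂ _+_ (count-blocked (x , y) right (pathsTo r (suc u)) (right-blocked on))
                     (count-free (x , y) up (pathsTo (suc r) u) (up-free x y)) ⟩
      V (x , suc y) (suc r) u
        ≡⟨ V-above-up (suc r) u 0 on end ⟩
      N k (suc r + u) (k + 0) 0
        ≡⟨ cong (λ L → N k L (k + 0) 0) (+-suc r u) ⟨
      N k (r + suc u) (k + 0) 0 ∎
    V-above (suc r) (suc u) {x} {y} (suc a) on end = begin
      count (noCross? (x , y)) (map (right ∷_) (pathsTo r (suc u)) ++ map (up ∷_) (pathsTo (suc r) u))
        ≡⟨ count-++ (noCross? (x , y)) (map (right ∷_) (pathsTo r (suc u))) _ ⟩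
      _ ≡⟨ cong₂ _+_ (count-free (x , y) right (pathsTo r (suc u)) (right-free-above on))
                     (count-free (x , y) up (pathsTo (suc r) u) (up-free x y)) ⟩
      V (suc x , y) r (suc u) + V (x , suc y) (suc r) u
        ≡⟨ cong₂ _+_ (V-above r (suc u) a (trans (sym (+-suc x a)) on) (suc-injective end))
                     (V-above-up (suc r) u (suc a) on end) ⟩
      N k (r + suc u) a 0 + N k (suc r + u) (k + suc a) 0
        ≡⟨ cong (λ L → N k (r + suc u) a 0 + N k L (k + suc a) 0) (+-suc r u) ⟨
      N k (suc r + suc u) (suc a) 0 ∎

    V-above-up r u {x} {y} a on end = V-above r u (k + a)
      (trans (+-left-comm x k a) (trans (cong (k +_) on) (sym (*-suc k y))))
      (trans (regroup k a u) end)
      where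
      +-left-comm : ∀ x k a → x + (k + a) ≡ k + (x + a)
      +-left-comm = solve-∀
      regroup : ∀ k a u → k + a + k * u ≡ a + k * suc u
      regroup = solve-∀

    -- The same argument at height `-1-h`: right steps are free below the diagonal, and an up step
    -- is what `jump` describes.
    V-below : ∀ r u {x y} h → x ≡ k * y + suc h → suc h + r ≡ k * u → V (x , y) r u ≡ G k (r + u) h
    V-below-up : ∀ r u {x y} h → x ≡ k * y + suc h → suc h + r ≡ k * suc u →
      V (x , suc y) r u ≡ jump k (G k (r + u)) (λ a → N k (r + u) a 0) h

    V-below r zero h on end = contradiction (trans end (*-zeroʳ k)) λ ()
    V-below zero (suc u) {x} {y} h on end = begin
      count (noCross? (x , y)) (map (up ∷_) (pathsTo zero u))
        ≡⟨ count-free (x , y) up (pathsTo zero u) (up-free x y) ⟩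
      V (x , suc y) zero u
        ≡⟨ V-below-up zero u h on end ⟩
      jump k (G k u) (λ a → N k u a 0) h
        -- No right step is left; the first summand of `G` vanishes because too few up steps remain
        -- to climb from `-1 - suc h`.
        ≡⟨ cong (_+ jump k (G k u) (λ a → N k u a 0) h) (G-vanish k u (suc h) far) ⟨
      G k (suc u) h ∎
      where
      far : k * u ≤ suc h
      far = ≤-trans (*-monoʳ-≤ k (n≤1+n u)) (≤-reflexive (trans (sym end) (+-identityʳ (suc h))))
    V-below (suc r) (suc u) {x} {y} h on end = begin
      count (noCross? (x , y)) (map (right ∷_) (pathsTo r (suc u)) ++ map (up ∷_) (pathsTo (suc r) u))
        ≡⟨ count-++ (noCross? (x , y)) (map (right ∷_) (pathsTo r (suc u))) _ ⟩
      _ ≡⟨ cong₂ _+_ (count-free (x , y) right (pathsTo r (suc u)) (right-free-below on))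
                     (count-free (x , y) up (pathsTo (suc r) u) (up-free x y)) ⟩
      V (suc x , y) r (suc u) + V (x , suc y) (suc r) u
        ≡⟨ cong₂ _+_ (V-below r (suc u) (suc h) (trans (cong suc on) (sym (+-suc (k * y) (suc h))))
                       (trans (sym (+-suc (suc h) r)) end))
                     (V-below-up (suc r) u h on end) ⟩
      G k (r + suc u) (suc h) + jump k (G k (suc r + u)) (λ a → N k (suc r + u) a 0) h
        ≡⟨ cong (λ L → G k (r + suc u) (suc h) + jump k (G k L) (λ a → N k L a 0) h) (+-suc r u) ⟨
      G k (suc r + suc u) h ∎

    -- The two branches of `jump`: the path is still below, at index `i = h - k`, or has reached
    -- height `j = k - 1 - h`.
    V-below-up r u {x} {y} h on end with k ≤? h
    ... | yes k≤h with m≤n⇒∃[o]m+o≡n k≤h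
    ...   | i , refl = trans
      (V-below r u i
        (trans on (regroup k y i))
        (+-cancelˡ-≡ k _ _ (trans (regroup′ k i r) (trans end (*-suc k u)))))
      (sym (jump-≥ k _ _ refl))
      where
      regroup : ∀ k y i → k * y + suc (k + i) ≡ k * suc y + suc i
      regroup = solve-∀
      regroup′ : ∀ k i r → k + (suc i + r) ≡ suc (k + i) + r
      regroup′ = solve-∀
    V-below-up r u {x} {y} h on end | no k≰h with m≤n⇒∃[o]m+o≡n (≰⇒> k≰h)
    ...   | j , h+j≡k = trans
      (V-above r u j
        (begin
          x + j               ≡⟨ cong (_+ j) on ⟩
          k * y + suc h + j   ≡⟨ +-assoc (k * y) (suc h) j ⟩
          k * y + (suc h + j) ≡⟨ cong (k * y +_) h+j≡k ⟩
          k * y + k           ≡⟨ +-comm (k * y) k ⟩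
          k + k * y           ≡⟨ *-suc k y ⟨
          k * suc y           ∎)
        (+-cancelˡ-≡ (suc h) _ _ (begin
          suc h + (j + k * u) ≡⟨ +-assoc (suc h) j (k * u) ⟨
          suc h + j + k * u   ≡⟨ cong (_+ k * u) h+j≡k ⟩
          k + k * u           ≡⟨ *-suc k u ⟨
          k * suc u           ≡⟨ end ⟨
          suc h + r           ∎)))
      (sym (jump-< k _ _ h+j≡k))

-- Excursions and valved paths compared.

e≡N : ∀ k n → k ≥ 1 → e k n ≡ N k (k * n + n) 0 0
e≡N k n k≥1 = trans
  (count-≐ (staysWeaklyAbove? k) (noCross? k origin) (excursion-≐ k) (pathsTo (k * n) n))
  (V-above k k≥1 (k * n) n 0 (sym (*-zeroʳ k)) refl)

v≡[k+1]*e : ∀ k n → k ≥ 1 → n ≥ 1 → v k n ≡ (k + 1) * e k n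
v≡[k+1]*e k@(suc k′) n@(suc u) k≥1 n≥1 = begin
  v k n
    ≡⟨ count-++ (valved? k) (map (right ∷_) (pathsTo r n)) _ ⟩
  count (valved? k) (map (right ∷_) (pathsTo r n)) + count (valved? k) (map (up ∷_) (pathsTo (suc r) u))
    -- Once the first step is known, `drop 1` computes, and `Valved` becomes `NoCross` from the
    -- second vertex.
    ≡⟨ cong₂ _+_ (count-map (valved? k) (right ∷_) (pathsTo r n))
                 (count-map (valved? k) (up ∷_) (pathsTo (suc r) u)) ⟩
  V k (1 , 0) r n + V k (0 , 1) (suc r) u
    ≡⟨ cong₂ _+_ (V-below k k≥1 r n 0 (cong (_+ 1) (sym (*-zeroʳ k))) refl)
                 (V-above-up k k≥1 (suc r) u 0 (sym (*-zeroʳ k)) refl) ⟩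
  G k (r + n) 0 + N k (suc r + u) (k + 0) 0
    ≡⟨ cong₂ _+_ (G≡k*N k (r + n)) (cong (λ L → N k L (k + 0) 0) (sym (+-suc r u))) ⟩
  k * N k (r + n) k 0 + N k (r + n) (k + 0) 0
    -- `N k (suc L) 0 0` computes to `N k L (k + 0) 0`, since a walk at height 0 must step up; hence
    -- `k` is rewritten as `k + 0`.
    ≡⟨ cong (λ a → k * N k (r + n) a 0 + N k (r + n) (k + 0) 0) (+-identityʳ k) ⟨
  k * N k (k * n + n) 0 0 + N k (k * n + n) 0 0
    ≡⟨ factor k _ ⟩
  (k + 1) * N k (k * n + n) 0 0
    ≡⟨ cong ((k + 1) *_) (e≡N k n k≥1) ⟨
  (k + 1) * e k n ∎
  where
  -- `k * n` computes to `suc r`.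
  r = u + k′ * n
  factor : ∀ k x → k * x + x ≡ (k + 1) * x
  factor = solve-∀

-- The closed form over the rationals.

open import Data.Integer using (+_)

-- Unnormalised fractions reduce the equation to cross-multiplication, with no gcd to handle. `mkℚᵘ`
-- stores the denominator minus one, whence `suc b`.
/-*-nat : ∀ a b c d → suc b * a ≡ c * d → + a / 1 ≡ (+ c / suc b) ℚ.* (+ d / 1)
/-*-nat a b c d eq = ℚ.toℚᵘ-injective
  (ℚᵘ.≃-trans (ℚ.toℚᵘ-fromℚᵘ (mkℚᵘ (+ a) 0))
  (ℚᵘ.≃-trans (*≡* cross)
  (ℚᵘ.≃-sym (ℚᵘ.≃-trans (ℚ.toℚᵘ-homo-* (+ c / suc b) (+ d / 1))
    (ℚᵘ.*-cong (ℚ.toℚᵘ-fromℚᵘ (mkℚᵘ (+ c) b)) (ℚ.toℚᵘ-fromℚᵘ (mkℚᵘ (+ d) 0)))))))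
  where
  cross : + a ℤ.* + (suc b * 1) ≡ + c ℤ.* + d ℤ.* + 1
  cross = begin
    + a ℤ.* + (suc b * 1)  ≡⟨ ℤ.pos-* a (suc b * 1) ⟨
    + (a * (suc b * 1))    ≡⟨ cong (λ m → + (a * m)) (*-identityʳ (suc b)) ⟩
    + (a * suc b)          ≡⟨ cong +_ (trans (*-comm a (suc b)) eq) ⟩
    + (c * d)              ≡⟨ ℤ.pos-* c d ⟩
    + c ℤ.* + d            ≡⟨ ℤ.*-identityʳ _ ⟨
    + c ℤ.* + d ℤ.* + 1    ∎

proposition12 : ∀ (k n : ℕ) → k ≥ 1 → n ≥ 1 →
    (v k n ≡ (k + 1) * e k n) ×
    (+ ((k + 1) * e k n) / 1 ≡ (+ (k + 1) / suc (k * n)) ℚ.* (+ ((k * n + n) C n) / 1))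
proposition12 k n@(suc u) k≥1 n≥1 =
  v≡[k+1]*e k n k≥1 n≥1 ,
  /-*-nat ((k + 1) * e k n) (k * n) (k + 1) ((k * n + n) C n) (begin
    suc (k * n) * ((k + 1) * e k n)   ≡⟨ *-left-comm (suc (k * n)) (k + 1) (e k n) ⟩
    (k + 1) * (suc (k * n) * e k n)   ≡⟨ cong (λ x → (k + 1) * (suc (k * n) * x)) (e≡N k n k≥1) ⟩
    (k + 1) * (suc (k * n) * N k (k * n + n) 0 0) ≡⟨ cong ((k + 1) *_) (N-closed k u) ⟩
    (k + 1) * ((k * n + n) C n)       ∎)
  where
  *-left-comm : ∀ x y z → x * (y * z) ≡ y * (x * z)
  *-left-comm = solve-∀
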